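{- A simple connected graph $G$ satisfies $\dim_{ms}(G)=1$ if and only if it is a path graph.
   Context: Graphs are simple and connected; $d_G(u,v)$ is the length of a shortest $u$–$v$ path in $G$. For $S=\{w_1,\ldots,w_t\}\subseteq V(G)$ and $u\in V(G)$, the multiset representation of $u$ with respect to $S$ is the multiset $\operatorname{m}(u|S)$ consisting of $d_G(u,w_1),\ldots,d_G(u,w_t)$, counted with multiplicity. A set $S\subseteq V(G)$ is an outer multiset resolving set if $\operatorname{m}(u|S)\ne \operatorname{m}(v|S)$ for every two distinct $u,v\in V(G)\setminus S$; the outer multiset dimension $\dim_{ms}(G)$ is the minimum cardinality of such a set. -}

module Defs where

open import Data.Empty using (⊥-elim)
open import Data.Fin using (Fin; zero; suc; toℕ)
open import Data.Fin.Properties using (_≟_; any?; all?)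
open import Data.Fin.Subset using (Subset; _∉_; ∣_∣; ⊤; Nonempty)
open import Data.Fin.Subset.Properties using (_∈?_; anySubset?; nonempty?; ∈⊤)
open import Data.List using (List; []; _∷_; _++_; allFin; filter; map)
open import Data.List.Membership.Propositional using () renaming (_∈_ to _∈ₗ_)
open import Data.List.Membership.Propositional.Properties using (∈-∃++)
open import Data.List.Relation.Binary.Permutation.Propositional
  using (_↭_; ↭-refl; ↭-sym; ↭-trans; prep)
open import Data.List.Relation.Binary.Permutation.Propositional.Properties
  using (∈-resp-↭; ¬x∷xs↭[]; shift; drop-mid)
open import Data.List.Relation.Unary.All using ([])
open import Data.List.Relation.Unary.All.Properties using (¬Any⇒All¬)
open import Data.List.Relation.Unary.AllPairs using ([]; _∷_)
open import Data.List.Relation.Unary.Any using (here; there)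
open import Data.List.Relation.Unary.Unique.Propositional using (Unique)
open import Data.Nat using (ℕ; zero; suc; _≤_; z≤n; s≤s; NonZero)
open import Data.Nat.Properties
  using (≤-refl; ≤-trans; m≤n⇒m≤1+n; 1+n≢n; suc-injective)
  renaming (_≟_ to _≟ℕ_)
open import Data.Product using (Σ; ∃-syntax; _×_; _,_; proj₁; proj₂)
open import Data.Sum using (_⊎_; inj₁; inj₂; [_,_]′; swap)
open import Function using (_∘_; _⇔_; _↔_; Inverse)
open import Level using (0ℓ)
open import Relation.Binary using (Rel; Symmetric; Irreflexive; Decidable)
open import Relation.Binary.PropositionalEquality
  using (_≡_; _≢_; refl; sym; cong)
open import Relation.Nullary using (¬_; Dec; yes; no)
open import Relation.Nullary.Decidable
  using (map′; _×-dec_; _⊎-dec_; _→-dec_; ¬?)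
import Data.List.Membership.DecPropositional as DecMembership
import Relation.Unary as U

------------------------------------------------------------------------
-- Minima of decidable predicates, and decidable equality of multisets

least : {P : ℕ → Set} → U.Decidable P → ∀ k → P k →
        ∃[ k ] P k × (∀ j → P j → k ≤ j)
least P? zero    p = zero , p , λ _ _ → z≤n
least P? (suc k) p with P? zero
... | yes p₀ = zero , p₀ , λ _ _ → z≤n
... | no ¬p₀ with m , pm , min ← least (P? ∘ suc) k p =
  suc m , pm , λ { zero p₀ → ⊥-elim (¬p₀ p₀) ; (suc j) pj → s≤s (min j pj) }

_↭?_ : Decidable (_↭_ {A = ℕ})
[]       ↭? []       = yes ↭-refl
[]       ↭? (y ∷ ys) = no (¬x∷xs↭[] ∘ ↭-sym)
(x ∷ xs) ↭? ys with DecMembership._∈?_ _≟ℕ_ x ys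
... | no x∉ys = no λ p → x∉ys (∈-resp-↭ p (here refl))
... | yes x∈ys with as , bs , refl ← ∈-∃++ x∈ys =
  map′ (λ p → ↭-trans (prep x p) (↭-sym (shift x as bs)))
       (drop-mid [] as)
       (xs ↭? (as ++ bs))

------------------------------------------------------------------------
-- Finite simple graphs

-- Decidability of adjacency is automatic classically.
record Graph (n : ℕ) : Set₁ where
  field
    Adj    : Rel (Fin n) 0ℓ
    symm   : Symmetric Adj
    irrefl : Irreflexive _≡_ Adj
    adj?   : Decidable Adj

record _≅_ {m n : ℕ} (G : Graph m) (H : Graph n) : Set where
  private
    module G = Graph G
    module H = Graph H
  field
    vertices : Fin m ↔ Fin n
  open Inverse vertices public using (to; from)
  field
    adjacent : ∀ u v → G.Adj u v ⇔ H.Adj (to u) (to v)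

pathGraph : (n : ℕ) → Graph n
pathGraph n = record
  { Adj    = λ i j → toℕ j ≡ suc (toℕ i) ⊎ toℕ i ≡ suc (toℕ j)
  ; symm   = swap
  ; irrefl = λ { refl → [ 1+n≢n ∘ sym , 1+n≢n ∘ sym ]′ }
  ; adj?   = λ i j → (toℕ j ≟ℕ suc (toℕ i)) ⊎-dec (toℕ i ≟ℕ suc (toℕ j))
  }

IsPathGraph : ∀ {n} → Graph n → Set
IsPathGraph G = ∃[ m ] G ≅ pathGraph m

------------------------------------------------------------------------
-- Walks and paths inside a graph

module _ {n : ℕ} (G : Graph n) where
  open Graph G

  data Walk : Fin n → Fin n → Set where
    nil  : ∀ {u} → Walk u u
    cons : ∀ {u v w} → Adj u v → Walk v w → Walk u w

module _ {n : ℕ} {G : Graph n} where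
  open Graph G

  walkLength : ∀ {u v} → Walk G u v → ℕ
  walkLength nil        = 0
  walkLength (cons _ w) = suc (walkLength w)

  support : ∀ {u v} → Walk G u v → List (Fin n)
  support {u} nil        = u ∷ []
  support {u} (cons _ w) = u ∷ support w

module _ {n : ℕ} (G : Graph n) where

  record Path (u v : Fin n) : Set where
    constructor path
    field
      walk   : Walk G u v
      unique : Unique (support walk)

    length : ℕ
    length = walkLength walk

  open Path public using (length)

  Connected : Set
  Connected = ∀ u v → Path u v

------------------------------------------------------------------------
-- Shortest paths exist

module _ {n : ℕ} {G : Graph n} where
  open Graph G

  suffix : ∀ {u v x} (w : Walk G u v) → Unique (support w) → x ∈ₗ support w →
           Σ (Path G x v) λ p → length p ≤ walkLength w
  suffix nil        un       (here refl) = path nil un , z≤n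
  suffix (cons a w) un       (here refl) = path (cons a w) un , ≤-refl
  suffix (cons a w) (_ ∷ un) (there x∈w) with p , le ← suffix w un x∈w =
    p , m≤n⇒m≤1+n le

  walk⇒path : ∀ {u v} (w : Walk G u v) → Σ (Path G u v) λ p → length p ≤ walkLength w
  walk⇒path nil = path nil ([] ∷ []) , z≤n
  walk⇒path {u} (cons a w) with path w′ un , le ← walk⇒path w
                           with DecMembership._∈?_ _≟_ u (support w′)
  ... | yes u∈w′ with p , le′ ← suffix w′ un u∈w′ =
    p , m≤n⇒m≤1+n (≤-trans le′ le)
  ... | no u∉w′ = path (cons a w′) (¬Any⇒All¬ _ u∉w′ ∷ un) , s≤s le

  walkOfLength? : ∀ k u v → Dec (∃[ w ] walkLength {G = G} {u} {v} w ≡ k)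
  walkOfLength? zero u v =
    map′ (λ { refl → nil , refl }) (λ { (nil , _) → refl }) (u ≟ v)
  walkOfLength? (suc k) u v =
    map′ (λ { (x , a , w , eq) → cons a w , cong suc eq })
         (λ { (cons a w , eq) → _ , a , w , suc-injective eq })
         (any? λ x → adj? u x ×-dec walkOfLength? k x v)

module _ {n : ℕ} (G : Graph n) (conn : Connected G) where

  shortestPath : ∀ u v → Σ (Path G u v) λ p → ∀ q → length p ≤ length q
  shortestPath u v
    with k , (w , refl) , min ←
           least (λ k → walkOfLength? {G = G} k u v)
                 (length (conn u v)) (Path.walk (conn u v) , refl)
    with p , le ← walk⇒path w =
    p , λ q → ≤-trans le (min (length q) (Path.walk q , refl))

  dist : Fin n → Fin n → ℕ
  dist u v = length (proj₁ (shortestPath u v))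

------------------------------------------------------------------------
-- Outer multiset dimension

elements : ∀ {n} → Subset n → List (Fin n)
elements {n} S = filter (_∈? S) (allFin n)

module _ {n : ℕ} (G : Graph n) (conn : Connected G) where

  -- A list standing for a multiset: compare only up to _↭_.
  multisetRep : Fin n → Subset n → List ℕ
  multisetRep u S = map (dist G conn u) (elements S)

  -- S = {w₁,…,w_t} is taken with t ≥ 1.  This matters only for the
  -- one-vertex graph, where ∅ would satisfy the second condition vacuously
  -- and the path on one vertex would have dimension 0.
  OuterMultisetResolving : Subset n → Set
  OuterMultisetResolving S =
    Nonempty S ×
    (∀ u v → u ∉ S → v ∉ S → u ≢ v → ¬ (multisetRep u S ↭ multisetRep v S))

  outerMultisetResolving? : U.Decidable OuterMultisetResolving
  outerMultisetResolving? S =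
    nonempty? S ×-dec
    all? λ u → all? λ v →
      ¬? (u ∈? S) →-dec ¬? (v ∈? S) →-dec ¬? (u ≟ v) →-dec
      ¬? (multisetRep u S ↭? multisetRep v S)

module _ {n : ℕ} .{{nz : NonZero n}} (G : Graph n) (conn : Connected G) where

  ⊤-resolving : OuterMultisetResolving G conn ⊤
  ⊤-resolving = nonempty n {{nz}} , λ _ _ u∉⊤ → ⊥-elim (u∉⊤ ∈⊤)
    where
    nonempty : ∀ n → .{{NonZero n}} → Nonempty {n} ⊤
    nonempty (suc n) = zero , ∈⊤

  minimumResolvingSet :
    Σ (Subset n) λ S → OuterMultisetResolving G conn S ×
                       (∀ T → OuterMultisetResolving G conn T → ∣ S ∣ ≤ ∣ T ∣)
  minimumResolvingSet
    with k , (S , res , refl) , min ←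
           least (λ k → anySubset? λ S →
                    outerMultisetResolving? G conn S ×-dec (∣ S ∣ ≟ℕ k))
                 ∣ ⊤ {n} ∣ (⊤ , ⊤-resolving , refl)
    = S , res , λ T resT → min ∣ T ∣ (T , resT , refl)

  outerMultisetDim : ℕ
  outerMultisetDim = ∣ proj₁ minimumResolvingSet ∣

{-# OPTIONS --safe #-}
-- A singleton {w} is resolving exactly when the distance to w is injective
-- (only w itself has distance 0).  Distances drop by at most one along an edge,
-- and each vertex other than w has a neighbour one step closer, so if the
-- distance to w is injective, it is an isomorphism onto a path.  Conversely, in
-- a path the distance to an end vertex is the position along the path.

module Submission where

open import Defs
open import Data.Fin using (Fin; zero; suc; toℕ; fromℕ<; inject₁; punchOut)
open import Data.Fin.Properties
  using (_≟_; any?; injective⇒≤; punchOut-injective; toℕ-fromℕ<; toℕ-injective; toℕ-inject₁)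
open import Data.Fin.Subset using (Subset; _∈_; ∣_∣; ⁅_⁆)
open import Data.Fin.Subset.Properties
  using (x∈⁅x⁆; x∈⁅y⁆⇒x≡y; x≢y⇒x∉⁅y⁆; ∣⁅x⁆∣≡1; ⊆-antisym; p⊆q⇒∣p∣≤∣q∣; p⊂q⇒∣p∣<∣q∣; _∈?_)
import Data.List as List
open import Data.List using (List; []; _∷_; lookup; allFin)
open import Data.List.Membership.Propositional using () renaming (_∈_ to _∈ₗ_)
open import Data.List.Membership.Propositional.Properties
  using (∈-filter⁺; ∈-filter⁻; ∈-allFin; ∈-lookup)
open import Data.List.Properties using (∷-injectiveˡ)
open import Data.List.Relation.Binary.Permutation.Propositional using (_↭_; ↭-reflexive)
open import Data.List.Relation.Binary.Permutation.Propositional.Properties using (↭-singleton-inv)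
import Data.List.Relation.Unary.All as All
open import Data.List.Relation.Unary.AllPairs using (_∷_)
open import Data.List.Relation.Unary.Any using (here; there)
open import Data.List.Relation.Unary.Unique.Propositional using (Unique)
open import Data.List.Relation.Unary.Unique.Propositional.Properties using (allFin⁺; filter⁺)
open import Data.Nat using (ℕ; zero; suc; _+_; _≤_; _<_; z≤n; s≤s; NonZero)
open import Data.Nat.Properties
  using (≤-refl; ≤-reflexive; ≤-trans; ≤-antisym; ≤-pred; <-irrefl; <-cmp; 1+n≰n;
         +-identityʳ; suc-injective; n≤1+n; m≤n⇒m≤1+n)
open import Data.Product using (∃-syntax; _×_; _,_; proj₁; proj₂)
open import Data.Sum using (_⊎_; inj₁; inj₂; [_,_]′)
open import Function using (_∘_; _⇔_; mk⇔; mk↔ₛ′; Injective; Equivalence; Inverse)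
open import Relation.Binary using (tri<; tri≈; tri>)
open import Relation.Binary.PropositionalEquality
  using (_≡_; _≢_; refl; sym; trans; cong; subst)
open import Relation.Nullary using (yes; no; contradiction)
open import Relation.Nullary.Decidable using (decidable-stable)

-- Finite sets and lists

unique-lookup-injective : ∀ {A : Set} {xs : List A} → Unique xs →
                          Injective _≡_ _≡_ (lookup xs)
unique-lookup-injective (_ ∷ _)  {zero}  {zero}  _  = refl
unique-lookup-injective (x≢ ∷ _) {zero}  {suc j} eq = contradiction eq (All.lookup x≢ (∈-lookup j))
unique-lookup-injective (x≢ ∷ _) {suc i} {zero}  eq =
  contradiction (sym eq) (All.lookup x≢ (∈-lookup i))
unique-lookup-injective (_ ∷ un) {suc i} {suc j} eq = cong suc (unique-lookup-injective un eq)

-- Pigeonhole: indexing a duplicate-free list is an injection into `Fin n`.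
unique⇒length≤ : ∀ {n} {xs : List (Fin n)} → Unique xs → List.length xs ≤ n
unique⇒length≤ un = injective⇒≤ (unique-lookup-injective un)

unique∧constant⇒singleton : ∀ {A : Set} {x : A} {xs} → Unique xs →
                            (∀ {y} → y ∈ₗ xs → y ≡ x) → x ∈ₗ xs → xs ≡ x ∷ []
unique∧constant⇒singleton {xs = _ ∷ []}    _              const _ = cong (_∷ []) (const (here refl))
unique∧constant⇒singleton {xs = y ∷ z ∷ _} ((y≢z All.∷ _) ∷ _) const _ =
  contradiction (trans (const (here refl)) (sym (const (there (here refl))))) y≢z

-- `elements` filters the duplicate-free `allFin n`, so membership alone already fixes the list.
elements-⁅⁆ : ∀ {n} (w : Fin n) → elements ⁅ w ⁆ ≡ w ∷ []
elements-⁅⁆ {n} w = unique∧constant⇒singleton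
  (filter⁺ (_∈? ⁅ w ⁆) (allFin⁺ n))
  (λ y∈ → x∈⁅y⁆⇒x≡y w (proj₂ (∈-filter⁻ (_∈? ⁅ w ⁆) {xs = allFin n} y∈)))
  (∈-filter⁺ (_∈? ⁅ w ⁆) (∈-allFin w) (x∈⁅x⁆ w))

x∈p⇒⁅x⁆⊆p : ∀ {n} {p : Subset n} {x y} → x ∈ p → y ∈ ⁅ x ⁆ → y ∈ p
x∈p⇒⁅x⁆⊆p {p = p} {x} x∈p y∈ = subst (_∈ p) (sym (x∈⁅y⁆⇒x≡y x y∈)) x∈p

∣p∣≡1⇒p≡⁅x⁆ : ∀ {n} {p : Subset n} {x} → x ∈ p → ∣ p ∣ ≡ 1 → p ≡ ⁅ x ⁆
∣p∣≡1⇒p≡⁅x⁆ {p = p} {x} x∈p ∣p∣≡1 = ⊆-antisym p⊆⁅x⁆ (x∈p⇒⁅x⁆⊆p x∈p)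
  where
  p⊆⁅x⁆ : ∀ {y} → y ∈ p → y ∈ ⁅ x ⁆
  p⊆⁅x⁆ {y} y∈p = decidable-stable (y ∈? ⁅ x ⁆) λ y∉ →
    -- A further element `y` makes the inclusion of `⁅ x ⁆` in `p` strict, which pushes `∣ p ∣`
    -- above 1.
    <-irrefl (trans (∣⁅x⁆∣≡1 x) (sym ∣p∣≡1))
             (p⊂q⇒∣p∣<∣q∣ (x∈p⇒⁅x⁆⊆p x∈p , y , y∈p , y∉))

injective⇒strictlySurjective : ∀ {n} {f : Fin n → Fin n} → Injective _≡_ _≡_ f →
                               ∀ j → ∃[ i ] f i ≡ j
injective⇒strictlySurjective {suc n} {f} inj j = decidable-stable (any? λ i → f i ≟ j) λ missed →
  let j≢f : ∀ i → j ≢ f i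
      j≢f i eq = missed (i , sym eq)
  -- Deleting the missed value `j` from the codomain leaves an injection from `Fin (suc n)` into
  -- `Fin n`.
  in 1+n≰n (injective⇒≤ {f = punchOut ∘ j≢f}
       (inj ∘ punchOut-injective (j≢f _) (j≢f _)))

consecutive : ∀ {a b} → a ≤ suc b → b ≤ suc a → a ≢ b → b ≡ suc a ⊎ a ≡ suc b
consecutive {a} {b} a≤ b≤ a≢b with <-cmp a b
... | tri< a<b _ _ = inj₁ (≤-antisym b≤ a<b)
... | tri≈ _ a≡b _ = contradiction a≡b a≢b
... | tri> _ _ b<a = inj₂ (≤-antisym a≤ b<a)

-- Distances

length-support : ∀ {n} {G : Graph n} {u v} (w : Walk G u v) →
                 List.length (support w) ≡ suc (walkLength w)
length-support nil        = refl
length-support (cons _ w) = cong suc (length-support w)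

module _ {n} (G : Graph n) (conn : Connected G) where
  open Graph G

  geodesic : ∀ u v → Walk G u v
  geodesic u v = Path.walk (proj₁ (shortestPath G conn u v))

  -- Every walk contains a path that is no longer, so upper bounds on distances need no check for
  -- repeated vertices.
  dist≤walkLength : ∀ {u v} (w : Walk G u v) → dist G conn u v ≤ walkLength w
  dist≤walkLength {u} {v} w with p , p≤w ← walk⇒path w =
    ≤-trans (proj₂ (shortestPath G conn u v) p) p≤w

  -- A path of length `d` visits `d + 1` distinct vertices. This lets distances be read as elements
  -- of `Fin n`.
  dist<n : ∀ u v → dist G conn u v < n
  dist<n u v = subst (_≤ n) (length-support (geodesic u v))
    (unique⇒length≤ (Path.unique (proj₁ (shortestPath G conn u v))))

  dist-self : ∀ w → dist G conn w w ≡ 0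
  dist-self w = ≤-antisym (dist≤walkLength nil) z≤n

  dist≡0⇒≡ : ∀ {u v} → dist G conn u v ≡ 0 → u ≡ v
  dist≡0⇒≡ {u} {v} eq with geodesic u v
  dist≡0⇒≡ _  | nil      = refl
  dist≡0⇒≡ () | cons _ _

  dist-adj : ∀ {u v} w → Adj u v → dist G conn u w ≤ suc (dist G conn v w)
  dist-adj {v = v} w a = dist≤walkLength (cons a (geodesic v w))

  -- Take the second vertex of a geodesic: the rest of the geodesic bounds its distance from above,
  -- and `dist-adj` bounds it from below.
  closerNeighbour : ∀ {u w k} → dist G conn u w ≡ suc k →
                    ∃[ v ] Adj u v × dist G conn v w ≡ k
  closerNeighbour {u} {w} {k} eq = go (geodesic u w) eq
    where
    go : (p : Walk G u w) → walkLength p ≡ suc k → ∃[ v ] Adj u v × dist G conn v w ≡ k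
    go (cons {v = v} a p) len = v , a , ≤-antisym
      (≤-trans (dist≤walkLength p) (≤-reflexive (suc-injective len)))
      (≤-pred (≤-trans (≤-reflexive (sym eq)) (dist-adj w a)))

  -- Singleton resolving sets

  Resolves : Fin n → Set
  Resolves w = ∀ u v → dist G conn u w ≡ dist G conn v w → u ≡ v

  multisetRep-⁅⁆ : ∀ u w → multisetRep G conn u ⁅ w ⁆ ≡ dist G conn u w ∷ []
  multisetRep-⁅⁆ u w = cong (List.map (dist G conn u)) (elements-⁅⁆ w)

  multisetRep-⁅⁆-↭ : ∀ u v w → (multisetRep G conn u ⁅ w ⁆ ↭ multisetRep G conn v ⁅ w ⁆) ⇔
                               (dist G conn u w ≡ dist G conn v w)
  multisetRep-⁅⁆-↭ u v w rewrite multisetRep-⁅⁆ u w | multisetRep-⁅⁆ v w =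
    mk⇔ (∷-injectiveˡ ∘ ↭-singleton-inv) (↭-reflexive ∘ cong (_∷ []))

  resolves⇒resolving : ∀ {w} → Resolves w → OuterMultisetResolving G conn ⁅ w ⁆
  resolves⇒resolving {w} inj = (w , x∈⁅x⁆ w) , λ u v _ _ u≢v →
    u≢v ∘ inj u v ∘ Equivalence.to (multisetRep-⁅⁆-↭ u v w)

  -- The outer condition compares only vertices other than `w`. The remaining cases follow because
  -- `w` alone has distance 0 to `w`.
  resolving⇒resolves : ∀ {w} → OuterMultisetResolving G conn ⁅ w ⁆ → Resolves w
  resolving⇒resolves {w} (_ , separates) u v eq with u ≟ w | v ≟ w
  ... | yes refl | _        = sym (dist≡0⇒≡ (trans (sym eq) (dist-self w)))
  ... | no _     | yes refl = dist≡0⇒≡ (trans eq (dist-self w))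
  ... | no u≢w   | no v≢w   = decidable-stable (u ≟ v) λ u≢v →
    separates u v (x≢y⇒x∉⁅y⁆ u≢w) (x≢y⇒x∉⁅y⁆ v≢w) u≢v
      (Equivalence.from (multisetRep-⁅⁆-↭ u v w) eq)

  resolves⇒isPathGraph : ∀ {w} → Resolves w → IsPathGraph G
  resolves⇒isPathGraph {w} inj = n , record
    { vertices = mk↔ₛ′ position (proj₁ ∘ surj) (proj₂ ∘ surj)
                       (λ u → position-injective (proj₂ (surj (position u))))
    ; adjacent = λ u v → mk⇔ (adj⇒ u v) (adj⇐ u v)
    }
    where
    position : Fin n → Fin n
    position u = fromℕ< (dist<n u w)

    toℕ-position : ∀ u → toℕ (position u) ≡ dist G conn u w
    toℕ-position u = toℕ-fromℕ< (dist<n u w)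

    position-injective : Injective _≡_ _≡_ position
    position-injective {u} {v} eq =
      inj u v (trans (sym (toℕ-position u)) (trans (cong toℕ eq) (toℕ-position v)))

    -- Source and target both have `n` elements, so no distance below `n` is skipped.
    surj : ∀ j → ∃[ i ] position i ≡ j
    surj = injective⇒strictlySurjective position-injective

    adj⇒ : ∀ u v → Adj u v → Graph.Adj (pathGraph n) (position u) (position v)
    adj⇒ u v a rewrite toℕ-position u | toℕ-position v =
      consecutive (dist-adj w a) (dist-adj w (symm a)) λ eq → irrefl (inj u v eq) a

    closer⇒adj : ∀ {u v} → dist G conn u w ≡ suc (dist G conn v w) → Adj u v
    -- The closer neighbour `x` of `u` has the same distance to `w` as `v`, so injectivity makes it
    -- `v`.
    closer⇒adj {u} eq with x , a , eq′ ← closerNeighbour eq = subst (Adj u) (inj _ _ eq′) a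

    adj⇐ : ∀ u v → Graph.Adj (pathGraph n) (position u) (position v) → Adj u v
    adj⇐ u v rewrite toℕ-position u | toℕ-position v = [ symm ∘ closer⇒adj , closer⇒adj ]′

-- Distances to an end of a path graph

module _ {n m} (G : Graph n) (conn : Connected G) (G≅P : G ≅ pathGraph (suc m)) where
  open Graph G
  open _≅_ G≅P

  private
    position : Fin n → ℕ
    position = toℕ ∘ to

    end : Fin n
    end = from zero

    to∘from : ∀ i → to (from i) ≡ i
    to∘from = Inverse.strictlyInverseˡ vertices

    -- Each edge lowers the position by at most one. For walks to `end`, at position 0, this is the
    -- lower bound on the distance.
    position≤ : ∀ {u v} (w : Walk G u v) → position u ≤ walkLength w + position v
    position≤ nil = ≤-refl
    position≤ (cons {u} {v} a w) with Equivalence.to (adjacent u v) a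
    ... | inj₁ eq = m≤n⇒m≤1+n (≤-trans (n≤1+n _) (≤-trans (≤-reflexive (sym eq)) (position≤ w)))
    ... | inj₂ eq = ≤-trans (≤-reflexive eq) (s≤s (position≤ w))

    -- Walk straight down the path, one index at a time. The recursion is on `k` because `inject₁ i`
    -- is not a subterm of `suc i`.
    walkToEnd : ∀ k (i : Fin (suc m)) → toℕ i ≡ k → ∃[ w ] walkLength {G = G} {from i} {end} w ≡ k
    walkToEnd zero    zero    _  = nil , refl
    walkToEnd (suc k) (suc i) eq
      with w , refl ← walkToEnd k (inject₁ i) (trans (toℕ-inject₁ i) (suc-injective eq)) =
      cons (Equivalence.from (adjacent _ _) (inj₂ step)) w , refl
      where
      step : position (from (suc i)) ≡ suc (position (from (inject₁ i)))
      step rewrite to∘from (suc i) | to∘from (inject₁ i) = cong suc (sym (toℕ-inject₁ i))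

    from∘to : ∀ u → from (to u) ≡ u
    from∘to = Inverse.strictlyInverseʳ vertices

    dist-end : ∀ i → dist G conn (from i) end ≡ toℕ i
    dist-end i = ≤-antisym upper lower
      where
      upper : dist G conn (from i) end ≤ toℕ i
      upper with w , len ← walkToEnd (toℕ i) i refl =
        ≤-trans (dist≤walkLength G conn w) (≤-reflexive len)
      lower : toℕ i ≤ dist G conn (from i) end
      lower = ≤-trans (≤-reflexive (sym (cong toℕ (to∘from i))))
        (≤-trans (position≤ (geodesic G conn (from i) end))
          (≤-reflexive (trans (cong (λ j → dist G conn (from i) end + toℕ j) (to∘from zero))
                              (+-identityʳ _))))

  end-resolves : Resolves G conn end
  end-resolves u v eq = trans (sym (from∘to u)) (trans (cong from to-≡) (from∘to v))
    where
    dist-end′ : ∀ u → dist G conn u end ≡ position u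
    dist-end′ u = trans (cong (λ x → dist G conn x end) (sym (from∘to u))) (dist-end (to u))

    to-≡ : to u ≡ to v
    to-≡ = toℕ-injective (trans (sym (dist-end′ u)) (trans eq (dist-end′ v)))

-- Dimension one

isPathGraph⇒resolves : ∀ {n} .{{_ : NonZero n}} (G : Graph n) (conn : Connected G) →
                       IsPathGraph G → ∃[ w ] Resolves G conn w
-- A graph with a vertex cannot map to the empty path graph, so an end vertex exists.
isPathGraph⇒resolves {suc n} G conn (zero  , G≅P) with () ← _≅_.to G≅P zero
isPathGraph⇒resolves G conn (suc m , G≅P) = _≅_.from G≅P zero , end-resolves G conn G≅P

dim≡1⇔resolves : ∀ {n} .{{_ : NonZero n}} (G : Graph n) (conn : Connected G) →
                 outerMultisetDim G conn ≡ 1 ⇔ (∃[ w ] Resolves G conn w)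
dim≡1⇔resolves G conn with minimumResolvingSet G conn
... | S , res@((x , x∈S) , _) , min = mk⇔
  (λ ∣S∣≡1 → x , resolving⇒resolves G conn
    (subst (OuterMultisetResolving G conn) (∣p∣≡1⇒p≡⁅x⁆ x∈S ∣S∣≡1) res))
  -- Minimality compares `S` with `⁅ w ⁆` from above; the element `x` of the nonempty `S` gives the
  -- bound from below.
  (λ (w , inj) → ≤-antisym
    (≤-trans (min ⁅ w ⁆ (resolves⇒resolving G conn inj)) (≤-reflexive (∣⁅x⁆∣≡1 w)))
    (≤-trans (≤-reflexive (sym (∣⁅x⁆∣≡1 x))) (p⊆q⇒∣p∣≤∣q∣ (x∈p⇒⁅x⁆⊆p x∈S))))

mainTheorem5 : ∀ {n : ℕ} .{{_ : NonZero n}} (G : Graph n) (conn : Connected G) →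
    outerMultisetDim G conn ≡ 1 ⇔ IsPathGraph G
mainTheorem5 G conn = mk⇔
  (resolves⇒isPathGraph G conn ∘ proj₂ ∘ Equivalence.to (dim≡1⇔resolves G conn))
  (Equivalence.from (dim≡1⇔resolves G conn) ∘ isPathGraph⇒resolves G conn)
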